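{- $f_3(6,5)=4=\rho_3\big(T_4(8)\big)$.
   Context: All graphs are finite and simple. For integers $\Delta,\omega$, let $\mathcal{G}(\Delta,\omega)$ be the class of graphs $G$ with maximum degree $\Delta(G)\le\Delta$ and clique number $\omega(G)\le\omega$. For a graph $G$, $k_t(G)$ denotes the number of copies of $K_t$ in $G$, and $\rho_t(G)=k_t(G)/|V(G)|$. For a positive integer $n$ let $k_t(n,\Delta,\omega)=\max\{k_t(G): |V(G)|=n,\ G\in\mathcal{G}(\Delta,\omega)\}$, and define $f_t(\Delta,\omega)=\lim_{n\to\infty}k_t(n,\Delta,\omega)/n$ (this limit exists and equals $\sup_{n}k_t(n,\Delta,\omega)/n$). $T_r(n)$ denotes the Turán graph: the complete $r$-partite graph on $n$ vertices whose part sizes differ by at most one. -}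

module Defs where

open import Data.Nat using (ℕ; zero; suc; _+_; _*_; _≤_; _<_; _%_; _≡ᵇ_)
open import Data.Bool using (Bool; true; false; _∧_; _∨_; not; if_then_else_)
open import Data.Fin using (Fin; toℕ; _≟_)
open import Data.Fin.Subset using (Subset; inside; outside; ∣_∣)
open import Data.Vec using (Vec; []; _∷_; lookup)
open import Data.List using (List; []; _∷_; map; _++_; length; allFin)
open import Relation.Nullary.Decidable using (⌊_⌋)
open import Relation.Binary.PropositionalEquality using (_≡_; _≢_)
open import Data.Product using (Σ; _×_)

count : {A : Set} → (A → Bool) → List A → ℕ
count p [] = 0
count p (x ∷ xs) = if p x then suc (count p xs) else count p xs

allᵇ : {A : Set} → (A → Bool) → List A → Bool
allᵇ p [] = true
allᵇ p (x ∷ xs) = p x ∧ allᵇ p xs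

record Graph : Set where
  field
    n      : ℕ
    adj    : Fin n → Fin n → Bool
    sym    : ∀ i j → adj i j ≡ adj j i
    irrefl : ∀ i → adj i i ≡ false
open Graph public

∣V∣ : Graph → ℕ
∣V∣ G = n G

degree : (G : Graph) → Fin (n G) → ℕ
degree G i = count (λ j → adj G i j) (allFin (n G))

allSubsets : (m : ℕ) → List (Subset m)
allSubsets zero = [] ∷ []
allSubsets (suc m) = map (outside ∷_) (allSubsets m) ++ map (inside ∷_) (allSubsets m)

isCliqueᵇ : (G : Graph) → Subset (n G) → Bool
isCliqueᵇ G S =
  allᵇ (λ i → allᵇ (λ j → not (lookup S i ∧ lookup S j ∧ not ⌊ i ≟ j ⌋) ∨ adj G i j)
                 (allFin (n G)))
      (allFin (n G))

IsClique : (G : Graph) → Subset (n G) → Set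
IsClique G S = isCliqueᵇ G S ≡ true

k : ℕ → Graph → ℕ
k t G = count (λ S → (∣ S ∣ ≡ᵇ t) ∧ isCliqueᵇ G S) (allSubsets (n G))

MaxDegreeAtMost : ℕ → Graph → Set
MaxDegreeAtMost Δ G = ∀ i → degree G i ≤ Δ

CliqueNumberAtMost : ℕ → Graph → Set
CliqueNumberAtMost ω G = ∀ (S : Subset (n G)) → IsClique G S → ∣ S ∣ ≤ ω

InClass : ℕ → ℕ → Graph → Set
InClass Δ ω G = MaxDegreeAtMost Δ G × CliqueNumberAtMost ω G

-- ρ_t(G) = a / b  (b > 0), i.e. b · k_t(G) = a · |V(G)|
RhoEquals : ℕ → Graph → ℕ → ℕ → Set
RhoEquals t G a b = b * k t G ≡ a * ∣V∣ G

-- f_t(Δ,ω) = sup_n k_t(n,Δ,ω)/n = a / b  (b > 0).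
-- Since k_t(n,Δ,ω) is the max of k_t(G) over G ∈ 𝒢(Δ,ω) on n vertices,
-- this sup equals the sup of k_t(G)/|V(G)| over all nonempty G ∈ 𝒢(Δ,ω):
--  * upper bound:  k_t(G)/|V(G)| ≤ a/b for all G in the class;
--  * least:        for every rational p/q < a/b some G in the class has
--                  k_t(G)/|V(G)| > p/q.
FEquals : ℕ → ℕ → ℕ → ℕ → ℕ → Set
FEquals t Δ ω a b =
  (∀ (G : Graph) → InClass Δ ω G → b * k t G ≤ a * ∣V∣ G)
  × (∀ (p q : ℕ) → 0 < q → p * b < a * q →
       Σ Graph (λ G → InClass Δ ω G × (p * ∣V∣ G < q * k t G)))

-- Turán graph T_r(m): vertex i lies in part (i mod r); vertices adjacent
-- iff in different parts.  Part sizes differ by at most one.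
turán : (r : ℕ) → .{{_ : Data.Nat.NonZero r}} → ℕ → Graph
turán r m = record
  { n = m
  ; adj = λ i j → not (toℕ i % r ≡ᵇ toℕ j % r)
  ; sym = λ i j → symᵇ (toℕ i % r) (toℕ j % r)
  ; irrefl = λ i → irr (toℕ i % r)
  }
  where
  open import Data.Nat.Properties using (≡ᵇ⇒≡; ≡⇒≡ᵇ)
  open import Relation.Binary.PropositionalEquality using (refl; cong)
  symᵇ : ∀ x y → not (x ≡ᵇ y) ≡ not (y ≡ᵇ x)
  symᵇ zero zero = refl
  symᵇ zero (suc y) = refl
  symᵇ (suc x) zero = refl
  symᵇ (suc x) (suc y) = symᵇ x y
  irr : ∀ x → not (x ≡ᵇ x) ≡ false
  irr zero = refl
  irr (suc x) = irr x

{-# OPTIONS --safe #-}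
-- A triangle is counted by the number t(v) of edges in N(v) for each of its three vertices v, so it
-- suffices to show Σ t(v) ≤ 12 n. Since N(v) has at most six vertices and contains no K₅, t(v) ≥ 13
-- forces N(v) to be K₆ minus two disjoint edges aa′ and bb′, whence t(v) = 13. The other two vertices
-- c, d of N(v) are then twins of v, and so the only possible neighbour of a outside N[v] is adjacent
-- to none of v, c, d; this gives t(a) ≤ 11, and likewise for a′, b, b′. Hence a vertex with t = 13 has
-- at least four neighbours with t ≤ 11. Conversely every u adjacent to v with t(v) = 13 is adjacent
-- to both a, a′ or to both b, b′, so at most four of its neighbours have t = 13. Double counting
-- shows that vertices with t ≤ 11 are at least as many as vertices with t = 13.

module Submission where

open import Defs
open import Data.Product using (_×_; _,_; proj₁; proj₂; ∃-syntax)
open import Data.Nat using (ℕ; zero; suc; _+_; _*_; _≤_; _<_; _≤ᵇ_; _≡ᵇ_; pred; z≤n; s≤s; _≤?_)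
open import Data.Nat.Properties hiding (_≟_)
open import Algebra.Properties.CommutativeSemigroup +-commutativeSemigroup using (interchange)
open import Data.Nat.ListAction using (sum)
open import Data.Nat.ListAction.Properties using (sum-↭)
open import Data.Nat.Solver using (module +-*-Solver)
open import Data.Bool using (Bool; true; false; _∧_; _∨_; not; T)
open import Data.Bool.Properties using (T?; T-≡)
open import Data.Fin using (Fin; zero; suc; _≟_)
open import Data.Fin.Properties using (all?) renaming (suc-injective to Fin-suc-injective)
open import Data.Fin.Subset using (Subset; inside; outside; ∣_∣; ⊥; ⁅_⁆; _∪_) renaming (_∈_ to _∈ˢ_; _∉_ to _∉ˢ_)
open import Data.Fin.Subset.Properties using (anySubset?; ∉⊥; x∈⁅x⁆; x∈⁅y⁆⇒x≡y; x∈p∪q⁻; x∈p∪q⁺; p⊂q⇒∣p∣<∣q∣; q⊆p∪q)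
open import Data.Vec using (lookup; []; _∷_; here; there)
open import Data.Vec.Properties using ([]=⇒lookup; lookup⇒[]=)
open import Data.List using (List; []; _∷_; map; _++_; length; allFin; tabulate; filterᵇ)
open import Data.List.Properties using (map-cong; map-tabulate; length-tabulate; length-++; ++-identityʳ)
open import Data.List.Relation.Unary.All as All using (All; []; _∷_)
open import Data.List.Relation.Unary.Any using (here; there)
open import Data.List.Relation.Unary.AllPairs as AllPairs using (AllPairs; []; _∷_)
open import Data.List.Relation.Unary.Unique.Propositional using (Unique)
open import Data.List.Relation.Unary.Unique.Propositional.Properties using (allFin⁺; filter⁺)
open import Data.List.Membership.Propositional using (_∈_)
open import Data.List.Membership.Propositional.Properties using (∈-filter⁺; ∈-filter⁻; ∈-allFin)
open import Data.List.Relation.Binary.Permutation.Propositional using (_↭_; refl; prep; swap; trans; ↭-refl; ↭⇒↭ₛ)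
open import Data.List.Relation.Binary.Permutation.Propositional.Properties using (map⁺; All-resp-↭; ∈-resp-↭; ↭-length; ++-comm; ++⁺ˡ; ++⁺ʳ)
open import Data.Sum using (_⊎_; inj₁; inj₂)
open import Function using (_∘_; id)
open import Function.Bundles using (Equivalence)
open import Relation.Nullary using (¬_; yes; no; contradiction)
open import Relation.Nullary.Decidable using (⌊_⌋; from-yes; from-no; _×-dec_)
open import Relation.Binary.PropositionalEquality using (_≡_; _≢_; refl; cong; cong₂; subst) renaming (sym to ≡-sym; trans to ≡-trans)
import Data.Bool as Bool
import Data.List.Relation.Binary.Permutation.Setoid.Properties as Permutationₛ
import Relation.Binary.PropositionalEquality.Properties as ≡

private variable
  A B : Set

-- Sums over the entries, pairs and triples of a list.

∑ : List A → (A → ℕ) → ℕ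
∑ xs f = sum (map f xs)

pairSum : (A → A → ℕ) → List A → ℕ
pairSum f []       = 0
pairSum f (x ∷ xs) = ∑ xs (f x) + pairSum f xs

tripleSum : (A → A → A → ℕ) → List A → ℕ
tripleSum g []       = 0
tripleSum g (x ∷ xs) = pairSum (g x) xs + tripleSum g xs

𝟙 : Bool → ℕ
𝟙 true  = 1
𝟙 false = 0

∑-cong : {f g : A → ℕ} (xs : List A) → (∀ x → f x ≡ g x) → ∑ xs f ≡ ∑ xs g
∑-cong xs f≡g = cong sum (map-cong f≡g xs)

∑-mono : {f g : A → ℕ} (xs : List A) → (∀ x → f x ≤ g x) → ∑ xs f ≤ ∑ xs g
∑-mono []       f≤g = z≤n
∑-mono (x ∷ xs) f≤g = +-mono-≤ (f≤g x) (∑-mono xs f≤g)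

∑-+ : (xs : List A) (f g : A → ℕ) → ∑ xs (λ x → f x + g x) ≡ ∑ xs f + ∑ xs g
∑-+ []       f g = refl
∑-+ (x ∷ xs) f g rewrite ∑-+ xs f g = interchange (f x) (g x) (∑ xs f) (∑ xs g)

∑-*ˡ : (xs : List A) (c : ℕ) (f : A → ℕ) → ∑ xs (λ x → c * f x) ≡ c * ∑ xs f
∑-*ˡ []       c f = ≡-sym (*-zeroʳ c)
∑-*ˡ (x ∷ xs) c f rewrite ∑-*ˡ xs c f = ≡-sym (*-distribˡ-+ c (f x) (∑ xs f))

∑-const : (xs : List A) (c : ℕ) → ∑ xs (λ _ → c) ≡ c * length xs
∑-const []       c = ≡-sym (*-zeroʳ c)
∑-const (x ∷ xs) c rewrite ∑-const xs c = ≡-sym (*-suc c (length xs))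

∑-≤-length : {f : A → ℕ} (xs : List A) → (∀ x → f x ≤ 1) → ∑ xs f ≤ length xs
∑-≤-length []       f≤1 = z≤n
∑-≤-length (x ∷ xs) f≤1 = +-mono-≤ (f≤1 x) (∑-≤-length xs f≤1)

∑-comm : (xs : List A) (ys : List B) (f : A → B → ℕ) →
         ∑ xs (λ x → ∑ ys (f x)) ≡ ∑ ys (λ y → ∑ xs (λ x → f x y))
∑-comm []       ys f = ≡-sym (∑-const ys 0)
∑-comm (x ∷ xs) ys f rewrite ∑-comm xs ys f = ≡-sym (∑-+ ys (f x) _)

∑-↭ : {xs ys : List A} (f : A → ℕ) → xs ↭ ys → ∑ xs f ≡ ∑ ys f
∑-↭ f xs↭ys = sum-↭ (map⁺ f xs↭ys)

∑-filterᵇ : (p : A → Bool) (f : A → ℕ) (xs : List A) →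
            ∑ (filterᵇ p xs) f ≡ ∑ xs (λ x → 𝟙 (p x) * f x)
∑-filterᵇ p f [] = refl
∑-filterᵇ p f (x ∷ xs) with p x
... | true  = cong₂ _+_ (≡-sym (*-identityˡ (f x))) (∑-filterᵇ p f xs)
... | false = ∑-filterᵇ p f xs

∑≡0⇒All : {f : A → ℕ} (xs : List A) → ∑ xs f ≡ 0 → All (λ x → f x ≡ 0) xs
∑≡0⇒All         []       _  = []
∑≡0⇒All {f = f} (x ∷ xs) eq = m+n≡0⇒m≡0 (f x) eq ∷ ∑≡0⇒All xs (m+n≡0⇒n≡0 (f x) eq)

-- The witness is delivered at the head of a permutation of `xs`, so that the sum can afterwards be
-- recomputed with its term split off.
∑-positive : {f : A → ℕ} (xs : List A) → 1 ≤ ∑ xs f → ∃[ x ] ∃[ ys ] xs ↭ x ∷ ys × 1 ≤ f x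
∑-positive {f = f} (x ∷ xs) 1≤∑ with f x in eq
... | suc _ = x , xs , ↭-refl , subst (1 ≤_) (≡-sym eq) (s≤s z≤n)
... | zero  with ∑-positive xs 1≤∑
...   | y , ys , p , 1≤fy = y , x ∷ ys , trans (prep x p) (swap x y refl) , 1≤fy

pairSum-cong : {f g : A → A → ℕ} (xs : List A) → (∀ x y → f x y ≡ g x y) → pairSum f xs ≡ pairSum g xs
pairSum-cong []       f≡g = refl
pairSum-cong (x ∷ xs) f≡g = cong₂ _+_ (∑-cong xs (f≡g x)) (pairSum-cong xs f≡g)

pairSum-+ : (f g : A → A → ℕ) (xs : List A) →
            pairSum f xs + pairSum g xs ≡ pairSum (λ x y → f x y + g x y) xs
pairSum-+ f g []       = refl
pairSum-+ f g (x ∷ xs) = ≡-trans (interchange (∑ xs (f x)) _ _ _)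
  (cong₂ _+_ (≡-sym (∑-+ xs (f x) (g x))) (pairSum-+ f g xs))

pairSum-filterᵇ : (p : A → Bool) (f : A → A → ℕ) (xs : List A) →
                  pairSum f (filterᵇ p xs) ≡ pairSum (λ x y → 𝟙 (p x) * (𝟙 (p y) * f x y)) xs
pairSum-filterᵇ p f [] = refl
pairSum-filterᵇ p f (x ∷ xs) with p x
... | true  = cong₂ _+_ (≡-trans (∑-filterᵇ p (f x) xs) (∑-cong xs (λ y → ≡-sym (*-identityˡ _))))
                        (pairSum-filterᵇ p f xs)
... | false = ≡-trans (pairSum-filterᵇ p f xs)
  (cong (_+ pairSum (λ x y → 𝟙 (p x) * (𝟙 (p y) * f x y)) xs) (≡-sym (∑-*ˡ xs 0 (λ y → 𝟙 (p y) * f x y))))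

-- A permutation may reverse the order in which a pair is met, and symmetry of `f` absorbs this. It
-- lets edges of a neighbourhood be counted in any convenient order of its vertices.
pairSum-↭ : {f : A → A → ℕ} → (∀ x y → f x y ≡ f y x) →
            {xs ys : List A} → xs ↭ ys → pairSum f xs ≡ pairSum f ys
pairSum-↭ f-sym refl = refl
pairSum-↭ {f = f} f-sym (prep x p) = cong₂ _+_ (∑-↭ (f x) p) (pairSum-↭ f-sym p)
pairSum-↭ {f = f} f-sym (swap {xs} {ys} x y p)
  rewrite f-sym x y | ∑-↭ (f x) p | ∑-↭ (f y) p | pairSum-↭ f-sym p =
  solve 4 (λ a b c d → (a :+ b) :+ (c :+ d) := (a :+ c) :+ (b :+ d)) refl
    (f y x) (∑ ys (f x)) (∑ ys (f y)) (pairSum f ys)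
  where open +-*-Solver
pairSum-↭ f-sym (trans p q) = ≡-trans (pairSum-↭ f-sym p) (pairSum-↭ f-sym q)

pairSum-positive : {f : A → A → ℕ} (xs : List A) → 1 ≤ pairSum f xs →
                   ∃[ x ] ∃[ y ] ∃[ ys ] xs ↭ x ∷ y ∷ ys × 1 ≤ f x y
pairSum-positive {f = f} (x ∷ xs) 1≤ with ∑ xs (f x) in eq
... | suc _ with ∑-positive xs (subst (1 ≤_) (≡-sym eq) (s≤s z≤n))
...   | y , ys , p , 1≤fxy = x , y , ys , prep x p , 1≤fxy
pairSum-positive {f = f} (x ∷ xs) 1≤ | zero with pairSum-positive xs 1≤
...   | y , z , ys , p , 1≤fyz =
  y , z , x ∷ ys , trans (prep x p) (trans (swap x y refl) (prep y (swap x z refl))) , 1≤fyz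

∑∑-symmetric : (f : A → A → ℕ) → (∀ x y → f x y ≡ f y x) → (∀ x → f x x ≡ 0) →
               (xs : List A) → ∑ xs (λ x → ∑ xs (f x)) ≡ 2 * pairSum f xs
∑∑-symmetric f f-sym f-irr [] = refl
∑∑-symmetric f f-sym f-irr (x ∷ xs)
  rewrite ∑-+ xs (λ y → f y x) (λ y → ∑ xs (f y))
        | ∑∑-symmetric f f-sym f-irr xs
        | ∑-cong xs (λ y → f-sym y x)
        | f-irr x =
  solve 2 (λ a b → a :+ (a :+ con 2 :* b) := con 2 :* (a :+ b)) refl (∑ xs (f x)) (pairSum f xs)
  where open +-*-Solver

-- Every triple is met once from each of its three members. With the head `x` split off, the triples
-- through `x` occur once in the term of `x` and twice in the terms of the other entries; triples
-- that repeat an entry contribute 0.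
∑-pairSum-symmetric : (g : A → A → A → ℕ) →
  (∀ x y z → g x y z ≡ g y x z) → (∀ x y z → g x y z ≡ g x z y) → (∀ x z → g x x z ≡ 0) →
  (xs : List A) → ∑ xs (λ x → pairSum (g x) xs) ≡ 3 * tripleSum g xs
∑-pairSum-symmetric g g-sym₁ g-sym₂ g-irr [] = refl
∑-pairSum-symmetric g g-sym₁ g-sym₂ g-irr (x ∷ xs)
  rewrite ∑-+ xs (λ y → ∑ xs (g y x)) (λ y → pairSum (g y) xs)
        | ∑-pairSum-symmetric g g-sym₁ g-sym₂ g-irr xs
        | ∑-cong xs (λ y → ∑-cong xs (λ z → g-sym₁ y x z))
        -- The diagonal `g x y y` vanishes because two transpositions carry it to `g y y x`.
        | ∑∑-symmetric (g x) (g-sym₂ x) (λ y → ≡-trans (g-sym₁ x y y) (≡-trans (g-sym₂ y x y) (g-irr y x))) xs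
        | ∑-cong xs (g-irr x)
        | ∑-const xs 0 =
  solve 2 (λ a b → a :+ (con 2 :* a :+ con 3 :* b) := con 3 :* (a :+ b)) refl (pairSum (g x) xs) (tripleSum g xs)
  where open +-*-Solver

-- Bounding the number of small subsets by sums over vertices.

count-++ : (p : A → Bool) (xs ys : List A) → count p (xs ++ ys) ≡ count p xs + count p ys
count-++ p []       ys = refl
count-++ p (x ∷ xs) ys with p x
... | true  = cong suc (count-++ p xs ys)
... | false = count-++ p xs ys

count-map : (p : B → Bool) (f : A → B) (xs : List A) → count p (map f xs) ≡ count (p ∘ f) xs
count-map p f []       = refl
count-map p f (x ∷ xs) with p (f x)
... | true  = cong suc (count-map p f xs)
... | false = count-map p f xs

count-false : (xs : List A) → count (λ _ → false) xs ≡ 0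
count-false []       = refl
count-false (x ∷ xs) = count-false xs

count≡length : (p : A → Bool) (xs : List A) → count p xs ≡ length (filterᵇ p xs)
count≡length p []       = refl
count≡length p (x ∷ xs) with p x
... | true  = cong suc (count≡length p xs)
... | false = count≡length p xs

∑-map : (h : A → B) (f : B → ℕ) (xs : List A) → ∑ (map h xs) f ≡ ∑ xs (f ∘ h)
∑-map h f []       = refl
∑-map h f (x ∷ xs) = cong (f (h x) +_) (∑-map h f xs)

pairSum-map : (h : A → B) (f : B → B → ℕ) (xs : List A) →
              pairSum f (map h xs) ≡ pairSum (λ x y → f (h x) (h y)) xs
pairSum-map h f []       = refl
pairSum-map h f (x ∷ xs) = cong₂ _+_ (∑-map h (f (h x)) xs) (pairSum-map h f xs)

tripleSum-map : (h : A → B) (g : B → B → B → ℕ) (xs : List A) →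
                tripleSum g (map h xs) ≡ tripleSum (λ x y z → g (h x) (h y) (h z)) xs
tripleSum-map h g []       = refl
tripleSum-map h g (x ∷ xs) = cong₂ _+_ (pairSum-map h (g (h x)) xs) (tripleSum-map h g xs)

-- With `q` taken to be `isCliqueᵇ G` this unfolds to `k t G`. A general `q` is what survives
-- recursion on `m`, where the first coordinate is fixed and absorbed into the predicate.
#subsets : ℕ → (m : ℕ) → (Subset m → Bool) → ℕ
#subsets t m q = count (λ S → (∣ S ∣ ≡ᵇ t) ∧ q S) (allSubsets m)

-- The test `suc ∣ S ∣ ≡ᵇ t` in the second summand reduces to `false` for `t = 0` and to the test
-- for size `t - 1` at a concrete positive `t`.
#subsets-split : ∀ t m (q : Subset (suc m) → Bool) →
  #subsets t (suc m) q ≡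
  #subsets t m (q ∘ (outside ∷_)) + count (λ S → (suc ∣ S ∣ ≡ᵇ t) ∧ q (inside ∷ S)) (allSubsets m)
#subsets-split t m q = ≡-trans
  (count-++ _ (map (outside ∷_) (allSubsets m)) _)
  (cong₂ _+_ (count-map _ (outside ∷_) (allSubsets m)) (count-map _ (inside ∷_) (allSubsets m)))

tabulate-suc : ∀ m → tabulate Fin.suc ≡ map Fin.suc (allFin m)
tabulate-suc m = ≡-sym (map-tabulate id Fin.suc)

-- Only the empty subset has size 0, so the count is at most 1. This is the bottom of a ladder up to
-- size 3: subsets containing the first vertex are handled by the bound one size lower, the others
-- by recursion on `m`.
#subsets₀-≤ : ∀ {m} {q : Subset m → Bool} {c} → (∀ {S} → q S ≡ true → 1 ≤ c) → #subsets 0 m q ≤ c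
#subsets₀-≤ {zero} {q} q⇒c with q [] in eq
... | true  = q⇒c eq
... | false = z≤n
#subsets₀-≤ {suc m} {q} {c} q⇒c
  rewrite #subsets-split 0 m q | count-false (allSubsets m) | +-identityʳ (#subsets 0 m (q ∘ (outside ∷_))) =
  #subsets₀-≤ {m = m} q⇒c

#subsets₁-≤ : ∀ {m} {q : Subset m → Bool} {f : Fin m → ℕ} →
  (∀ {S i} → q S ≡ true → i ∈ˢ S → 1 ≤ f i) → #subsets 1 m q ≤ ∑ (allFin m) f
#subsets₁-≤ {zero} q⇒f = z≤n
#subsets₁-≤ {suc m} {q} {f} q⇒f
  -- The commutation aligns two orders: `allSubsets` begins with the subsets that avoid the first
  -- vertex, while the sums begin with the first vertex itself. The next two sizes do the same.
  rewrite #subsets-split 1 m q | tabulate-suc m | ∑-map Fin.suc f (allFin m) | +-comm (f zero) (∑ (allFin m) (f ∘ suc)) =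
  +-mono-≤ (#subsets₁-≤ (λ qS i∈S → q⇒f qS (there i∈S)))
           (#subsets₀-≤ {m = m} (λ qS → q⇒f qS here))

#subsets₂-≤ : ∀ {m} {q : Subset m → Bool} {f : Fin m → Fin m → ℕ} →
  (∀ {S i j} → q S ≡ true → i ∈ˢ S → j ∈ˢ S → i ≢ j → 1 ≤ f i j) → #subsets 2 m q ≤ pairSum f (allFin m)
#subsets₂-≤ {zero} q⇒f = z≤n
#subsets₂-≤ {suc m} {q} {f} q⇒f
  rewrite #subsets-split 2 m q | tabulate-suc m | ∑-map Fin.suc (f zero) (allFin m) | pairSum-map Fin.suc f (allFin m)
        | +-comm (∑ (allFin m) (f zero ∘ suc)) (pairSum (λ i j → f (suc i) (suc j)) (allFin m)) =
  +-mono-≤ (#subsets₂-≤ (λ qS i∈S j∈S i≢j → q⇒f qS (there i∈S) (there j∈S) (i≢j ∘ Fin-suc-injective)))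
           (#subsets₁-≤ (λ qS j∈S → q⇒f qS here (there j∈S) (λ ())))

#subsets₃-≤ : ∀ {m} {q : Subset m → Bool} {g : Fin m → Fin m → Fin m → ℕ} →
  (∀ {S i j l} → q S ≡ true → i ∈ˢ S → j ∈ˢ S → l ∈ˢ S → i ≢ j → i ≢ l → j ≢ l → 1 ≤ g i j l) →
  #subsets 3 m q ≤ tripleSum g (allFin m)
#subsets₃-≤ {zero} q⇒g = z≤n
#subsets₃-≤ {suc m} {q} {g} q⇒g
  rewrite #subsets-split 3 m q | tabulate-suc m | pairSum-map Fin.suc (g zero) (allFin m) | tripleSum-map Fin.suc g (allFin m)
        | +-comm (pairSum (λ j l → g zero (suc j) (suc l)) (allFin m))
                 (tripleSum (λ i j l → g (suc i) (suc j) (suc l)) (allFin m)) =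
  +-mono-≤ (#subsets₃-≤ (λ qS i∈S j∈S l∈S i≢j i≢l j≢l →
              q⇒g qS (there i∈S) (there j∈S) (there l∈S)
                (i≢j ∘ Fin-suc-injective) (i≢l ∘ Fin-suc-injective) (j≢l ∘ Fin-suc-injective)))
           (#subsets₂-≤ (λ qS j∈S l∈S j≢l →
              q⇒g qS here (there j∈S) (there l∈S) (λ ()) (λ ()) (j≢l ∘ Fin-suc-injective)))

-- Boolean cliques, and lists of vertices as subsets.

allᵇ-sound : {p : A → Bool} {xs : List A} {x : A} → allᵇ p xs ≡ true → x ∈ xs → p x ≡ true
allᵇ-sound {p = p} {y ∷ ys} eq x∈ with p y in py
allᵇ-sound eq (here refl) | true = py
allᵇ-sound eq (there x∈)  | true = allᵇ-sound eq x∈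

allᵇ-complete : {p : A → Bool} (xs : List A) → (∀ x → p x ≡ true) → allᵇ p xs ≡ true
allᵇ-complete []       h = refl
allᵇ-complete (x ∷ xs) h rewrite h x = allᵇ-complete xs h

module _ (G : Graph) where

  isClique-sound : ∀ {S i j} → IsClique G S → i ∈ˢ S → j ∈ˢ S → i ≢ j → adj G i j ≡ true
  isClique-sound {S} {i} {j} clique i∈S j∈S i≢j
    with allᵇ-sound (allᵇ-sound clique (∈-allFin i)) (∈-allFin j)
  ... | eq rewrite []=⇒lookup i∈S | []=⇒lookup j∈S with i ≟ j
  ...   | yes i≡j = contradiction i≡j i≢j
  ...   | no  _   = eq

  isClique-complete : ∀ {S} → (∀ {i j} → i ∈ˢ S → j ∈ˢ S → i ≢ j → adj G i j ≡ true) → IsClique G S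
  isClique-complete {S} h = allᵇ-complete (allFin _) λ i → allᵇ-complete (allFin _) λ j → entry i j
    where
    entry : ∀ i j → (not (lookup S i ∧ lookup S j ∧ not ⌊ i ≟ j ⌋) ∨ adj G i j) ≡ true
    entry i j with lookup S i in i∈S | lookup S j in j∈S | i ≟ j
    ... | false | _     | _     = refl
    ... | true  | false | _     = refl
    ... | true  | true  | yes _ = refl
    ... | true  | true  | no i≢j = h (lookup⇒[]= i S i∈S) (lookup⇒[]= j S j∈S) i≢j

-- Cliques are found below as lists of pairwise adjacent vertices, whereas the clique number bounds
-- the size of subsets; this is the passage from one to the other.
⁅_⁆ₗ : ∀ {m} → List (Fin m) → Subset m
⁅ []     ⁆ₗ = ⊥
⁅ x ∷ xs ⁆ₗ = ⁅ x ⁆ ∪ ⁅ xs ⁆ₗ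

∈⁅⁆ₗ⁻ : ∀ {m x} (xs : List (Fin m)) → x ∈ˢ ⁅ xs ⁆ₗ → x ∈ xs
∈⁅⁆ₗ⁻ []       x∈ = contradiction x∈ ∉⊥
∈⁅⁆ₗ⁻ (y ∷ xs) x∈ with x∈p∪q⁻ ⁅ y ⁆ ⁅ xs ⁆ₗ x∈
... | inj₁ x∈y  = here (x∈⁅y⁆⇒x≡y y x∈y)
... | inj₂ x∈xs = there (∈⁅⁆ₗ⁻ xs x∈xs)

∣⁅x⁆∪p∣ : ∀ {m x} {p : Subset m} → x ∉ˢ p → suc ∣ p ∣ ≤ ∣ ⁅ x ⁆ ∪ p ∣
∣⁅x⁆∪p∣ {x = x} {p} x∉p = p⊂q⇒∣p∣<∣q∣ (q⊆p∪q ⁅ x ⁆ p , x , x∈p∪q⁺ (inj₁ (x∈⁅x⁆ x)) , x∉p)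

length≤∣⁅⁆ₗ∣ : ∀ {m} {xs : List (Fin m)} → Unique xs → length xs ≤ ∣ ⁅ xs ⁆ₗ ∣
length≤∣⁅⁆ₗ∣ [] = z≤n
length≤∣⁅⁆ₗ∣ {xs = x ∷ xs} (x∉xs ∷ uniq) =
  ≤-trans (s≤s (length≤∣⁅⁆ₗ∣ uniq)) (∣⁅x⁆∪p∣ (λ x∈ → All.lookup x∉xs (∈⁅⁆ₗ⁻ xs x∈) refl))

-- Indicators and rearrangement of lists.

𝟙-T : ∀ {b} → T b → 𝟙 b ≡ 1
𝟙-T {true} _ = refl

𝟙-¬T : ∀ {b} → ¬ T b → 𝟙 b ≡ 0
𝟙-¬T {true}  ¬t = contradiction _ ¬t
𝟙-¬T {false} _  = refl

𝟙≤1 : ∀ b → 𝟙 b ≤ 1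
𝟙≤1 true  = ≤-refl
𝟙≤1 false = z≤n

1≤𝟙⇒T : ∀ {b} → 1 ≤ 𝟙 b → T b
1≤𝟙⇒T {true} _ = _

∈⇒↭ : {x : A} {xs : List A} → x ∈ xs → ∃[ ys ] xs ↭ x ∷ ys
∈⇒↭ {xs = _ ∷ xs} (here refl) = xs , ↭-refl
∈⇒↭ {x = x} {y ∷ xs} (there x∈xs) with ∈⇒↭ x∈xs
... | ys , p = y ∷ ys , trans (prep y p) (swap y x refl)

-- The entries of `xs` are extracted from `ys` one at a time; being distinct, the later ones are
-- still there after each extraction. Applied to `N v`, it separates known neighbours from the
-- remaining ones.
Unique⇒↭++ : {xs ys : List A} → Unique xs → All (_∈ ys) xs → ∃[ zs ] ys ↭ xs ++ zs
Unique⇒↭++ {ys = ys} [] [] = ys , ↭-refl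
Unique⇒↭++ {A = A} {xs = x ∷ xs} {ys} (x∉xs ∷ uniq) (x∈ys ∷ xs⊆ys) with ∈⇒↭ x∈ys
... | ys′ , p with Unique⇒↭++ uniq (All.zipWith remove (x∉xs , xs⊆ys))
  where
  remove : {y : A} → x ≢ y × y ∈ ys → y ∈ ys′
  remove (x≢y , y∈ys) with ∈-resp-↭ p y∈ys
  ... | here y≡x   = contradiction (≡-sym y≡x) x≢y
  ... | there y∈   = y∈
...   | zs , q = zs , trans p (prep x q)

Unique-resp-↭ : {xs ys : List A} → xs ↭ ys → Unique xs → Unique ys
Unique-resp-↭ p = Permutationₛ.Unique-resp-↭ (≡.setoid _) (↭⇒↭ₛ p)

-- Used with p, x, y, z counting the non-edges of N(v) = {a, a′} ∪ W: the pair aa′, those from a to W,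
-- those from a′ to W, and those inside W.
slack : ∀ {p} x y {z} → 1 ≤ p → 1 ≤ x + z → 1 ≤ y + z → (p + x) + (y + z) ≤ 2 → x ≡ 0 × y ≡ 0 × z ≡ 1
slack {suc p} x y {zero} _ 1≤x 1≤y ≤2 =
  contradiction ≤2 (<⇒≱ (+-mono-≤ (s≤s (≤-trans (subst (1 ≤_) (+-identityʳ x) 1≤x) (m≤n+m x p))) 1≤y))
slack {suc p} x y {suc z} _ _ _ ≤2
  rewrite +-suc y z | +-suc (p + x) (y + z) with ≤2
... | s≤s (s≤s ≤0) with n≤0⇒n≡0 ≤0
...   | eq = m+n≡0⇒n≡0 p p+x≡0 , m+n≡0⇒m≡0 y y+z≡0 , cong suc (m+n≡0⇒n≡0 y y+z≡0)
  where
  p+x≡0 = m+n≡0⇒m≡0 (p + x) eq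
  y+z≡0 = m+n≡0⇒n≡0 (p + x) eq

-- Applied inside `W`, whose only non-edge is then `bb′`: `p` counts that pair, `x` the non-edges
-- from `b` to the last two vertices, and `y` those among the vertices other than `b`.
split₁ : ∀ {p x y} → 1 ≤ p → (p + x) + y ≡ 1 → x ≡ 0 × y ≡ 0
split₁ {suc p} {x} {y} _ eq = m+n≡0⇒n≡0 p (m+n≡0⇒m≡0 (p + x) p+x+y≡0) , m+n≡0⇒n≡0 (p + x) p+x+y≡0
  where
  p+x+y≡0 : p + x + y ≡ 0
  p+x+y≡0 = cong pred eq

-- Neighbourhoods and their edges.

module _ (G : Graph) where

  private
    V : List (Fin (n G))
    V = allFin (n G)

  infix 4 _~_ _≁_

  -- Since `adj` is irreflexive, `i ≁ i` holds. Hence distinctness of non-adjacent vertices is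
  -- always taken from the uniqueness of the list `N v`.
  _~_ _≁_ : Fin (n G) → Fin (n G) → Set
  i ~ j = T (adj G i j)
  i ≁ j = T (not (adj G i j))

  edge nonedge : Fin (n G) → Fin (n G) → ℕ
  edge i j    = 𝟙 (adj G i j)
  nonedge i j = 𝟙 (not (adj G i j))

  N : Fin (n G) → List (Fin (n G))
  N v = filterᵇ (adj G v) V

  t : Fin (n G) → ℕ
  t v = pairSum edge (N v)

  ~-sym : ∀ {i j} → i ~ j → j ~ i
  ~-sym {i} {j} = subst T (Graph.sym G i j)

  ≁-sym : ∀ {i j} → i ≁ j → j ≁ i
  ≁-sym {i} {j} = subst (T ∘ not) (Graph.sym G i j)

  ~⇒¬≁ : ∀ {i j} → i ~ j → ¬ i ≁ j
  ~⇒¬≁ {i} {j} with adj G i j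
  ... | true = λ _ ()

  ¬~⇒≁ : ∀ {i j} → ¬ i ~ j → i ≁ j
  ¬~⇒≁ {i} {j} ¬i~j with adj G i j
  ... | true  = ¬i~j _
  ... | false = _

  nonedge≡0⇒~ : ∀ {i j} → nonedge i j ≡ 0 → i ~ j
  nonedge≡0⇒~ {i} {j} with adj G i j
  ... | true = λ _ → _

  ~-irrefl : ∀ {i} → ¬ i ~ i
  ~-irrefl {i} = subst T (irrefl G i)

  ~⇒≢ : ∀ {i j} → i ~ j → i ≢ j
  ~⇒≢ i~i refl = ~-irrefl i~i

  edge-sym : ∀ i j → edge i j ≡ edge j i
  edge-sym i j = cong 𝟙 (Graph.sym G i j)

  nonedge-sym : ∀ i j → nonedge i j ≡ nonedge j i
  nonedge-sym i j = cong (𝟙 ∘ not) (Graph.sym G i j)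

  -- The right-hand side is the number of pairs of positions: 10 for five entries and 15 for six.
  -- Bounds on `t` thus become bounds on the number of non-edges.
  edge+nonedge : ∀ xs → pairSum edge xs + pairSum nonedge xs ≡ pairSum (λ _ _ → 1) xs
  edge+nonedge xs = ≡-trans (pairSum-+ edge nonedge xs) (pairSum-cong xs (λ i j → 𝟙-not (adj G i j)))
    where
    𝟙-not : ∀ b → 𝟙 b + 𝟙 (not b) ≡ 1
    𝟙-not true  = refl
    𝟙-not false = refl

  pairSum-edge≤10 : ∀ xs → length xs ≤ 5 → pairSum edge xs ≤ 10
  pairSum-edge≤10 xs len = ≤-trans (≤-trans (m≤m+n _ _) (≤-reflexive (edge+nonedge xs))) (bound xs len)
    where
    bound : (xs : List (Fin (n G))) → length xs ≤ 5 → pairSum (λ _ _ → 1) xs ≤ 10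
    bound []                          _ = z≤n
    bound (_ ∷ [])                    _ = z≤n
    bound (_ ∷ _ ∷ [])                _ = s≤s z≤n
    bound (_ ∷ _ ∷ _ ∷ [])            _ = m≤m+n 3 7
    bound (_ ∷ _ ∷ _ ∷ _ ∷ [])        _ = m≤m+n 6 4
    bound (_ ∷ _ ∷ _ ∷ _ ∷ _ ∷ [])    _ = ≤-refl
    bound (_ ∷ _ ∷ _ ∷ _ ∷ _ ∷ _ ∷ _) (s≤s (s≤s (s≤s (s≤s (s≤s ())))))

  ∈N : ∀ {v w} → v ~ w → w ∈ N v
  ∈N {v} {w} = ∈-filter⁺ (T? ∘ adj G v) (∈-allFin w)

  N-~ : ∀ v → All (v ~_) (N v)
  N-~ v = All.tabulate (λ w∈N → proj₂ (∈-filter⁻ (T? ∘ adj G v) {xs = V} w∈N))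

  N-unique : ∀ v → Unique (N v)
  N-unique v = filter⁺ (T? ∘ adj G v) (allFin⁺ (n G))

  AllPairs-~⇒IsClique : ∀ {xs} → AllPairs _~_ xs → IsClique G ⁅ xs ⁆ₗ
  AllPairs-~⇒IsClique {xs} pairs = isClique-complete G λ i∈ j∈ i≢j →
    Equivalence.to T-≡ (lookupPair pairs (∈⁅⁆ₗ⁻ xs i∈) (∈⁅⁆ₗ⁻ xs j∈) i≢j)
    where
    lookupPair : ∀ {xs i j} → AllPairs _~_ xs → i ∈ xs → j ∈ xs → i ≢ j → i ~ j
    lookupPair (_ ∷ _)  (here refl) (here refl) i≢i = contradiction refl i≢i
    lookupPair (x~ ∷ _) (here refl) (there j∈)  _   = All.lookup x~ j∈
    lookupPair (x~ ∷ _) (there i∈)  (here refl) _   = ~-sym (All.lookup x~ i∈)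
    lookupPair (_ ∷ ps) (there i∈)  (there j∈)  i≢j = lookupPair ps i∈ j∈ i≢j

  pairSum-nonedge≡0 : ∀ xs → pairSum nonedge xs ≡ 0 → AllPairs _~_ xs
  pairSum-nonedge≡0 []       _  = []
  pairSum-nonedge≡0 (x ∷ xs) eq =
    All.map nonedge≡0⇒~ (∑≡0⇒All xs (m+n≡0⇒m≡0 (∑ xs (nonedge x)) eq)) ∷
    pairSum-nonedge≡0 xs (m+n≡0⇒n≡0 (∑ xs (nonedge x)) eq)

  -- N(v) induces K₆ minus the edges aa′ and bb′.
  record Saturated (v a a′ b b′ c d : Fin (n G)) : Set where
    field
      N↭   : N v ↭ a ∷ a′ ∷ b ∷ b′ ∷ c ∷ d ∷ []
      a≁a′ : a ≁ a′
      b≁b′ : b ≁ b′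
      a~   : All (a ~_) (b ∷ b′ ∷ c ∷ d ∷ [])
      a′~  : All (a′ ~_) (b ∷ b′ ∷ c ∷ d ∷ [])
      b~   : All (b ~_) (c ∷ d ∷ [])
      b′~  : All (b′ ~_) (c ∷ d ∷ [])
      c~d  : c ~ d

  open Saturated

  -- This and the next two are symmetries of K₆ minus two disjoint edges. They carry what is proved
  -- for `a` to `a′`, `b` and `b′`, and what is proved for `c` to `d`.
  swap-aa′ : ∀ {v a a′ b b′ c d} → Saturated v a a′ b b′ c d → Saturated v a′ a b b′ c d
  swap-aa′ s = record
    { N↭ = trans (N↭ s) (swap _ _ refl) ; a≁a′ = ≁-sym (a≁a′ s) ; b≁b′ = b≁b′ s
    ; a~ = a′~ s ; a′~ = a~ s ; b~ = b~ s ; b′~ = b′~ s ; c~d = c~d s }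

  swap-ab : ∀ {v a a′ b b′ c d} → Saturated v a a′ b b′ c d → Saturated v b b′ a a′ c d
  swap-ab {a = a} {a′} {b} {b′} {c} {d} s with a~ s | a′~ s
  ... | a~b ∷ a~b′ ∷ a~cd | a′~b ∷ a′~b′ ∷ a′~cd = record
    { N↭ = trans (N↭ s) (++⁺ʳ (c ∷ d ∷ []) (++-comm (a ∷ a′ ∷ []) (b ∷ b′ ∷ [])))
    ; a≁a′ = b≁b′ s ; b≁b′ = a≁a′ s
    ; a~ = ~-sym a~b ∷ ~-sym a′~b ∷ b~ s ; a′~ = ~-sym a~b′ ∷ ~-sym a′~b′ ∷ b′~ s
    ; b~ = a~cd ; b′~ = a′~cd ; c~d = c~d s }

  swap-cd : ∀ {v a a′ b b′ c d} → Saturated v a a′ b b′ c d → Saturated v a a′ b b′ d c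
  swap-cd {a = a} {a′} {b} {b′} {c} {d} s with a~ s | a′~ s | b~ s | b′~ s
  ... | a~b ∷ a~b′ ∷ a~c ∷ a~d ∷ [] | a′~b ∷ a′~b′ ∷ a′~c ∷ a′~d ∷ [] | b~c ∷ b~d ∷ [] | b′~c ∷ b′~d ∷ [] = record
    { N↭ = trans (N↭ s) (++⁺ˡ (a ∷ a′ ∷ b ∷ b′ ∷ []) (swap c d refl))
    ; a≁a′ = a≁a′ s ; b≁b′ = b≁b′ s
    ; a~ = a~b ∷ a~b′ ∷ a~d ∷ a~c ∷ [] ; a′~ = a′~b ∷ a′~b′ ∷ a′~d ∷ a′~c ∷ []
    ; b~ = b~d ∷ b~c ∷ [] ; b′~ = b′~d ∷ b′~c ∷ [] ; c~d = ~-sym (c~d s) }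

  -- Local structure around a vertex with 13 triangles.

  module _ (deg≤6 : MaxDegreeAtMost 6 G) (ω≤5 : CliqueNumberAtMost 5 G) where

    length-N≤6 : ∀ v → length (N v) ≤ 6
    length-N≤6 v = subst (_≤ 6) (count≡length (adj G v) V) (deg≤6 v)

    -- Otherwise the five vertices together with `v` would form a K₆.
    five-neighbours : ∀ {v xs} → All (v ~_) xs → length xs ≡ 5 → 1 ≤ pairSum nonedge xs
    five-neighbours {v} {xs} v~xs len with pairSum nonedge xs in eq
    ... | suc _ = s≤s z≤n
    ... | zero  = contradiction (ω≤5 ⁅ v ∷ xs ⁆ₗ (AllPairs-~⇒IsClique clique)) (<⇒≱ six≤)
      where
      clique : AllPairs _~_ (v ∷ xs)
      clique = v~xs ∷ pairSum-nonedge≡0 xs eq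
      six≤ : 6 ≤ ∣ ⁅ v ∷ xs ⁆ₗ ∣
      six≤ = subst (_≤ ∣ ⁅ v ∷ xs ⁆ₗ ∣) (cong suc len) (length≤∣⁅⁆ₗ∣ (AllPairs.map ~⇒≢ clique))

    13≤t⇒length≡6 : ∀ v → 13 ≤ t v → length (N v) ≡ 6
    13≤t⇒length≡6 v 13≤t with length (N v) ≤? 5
    ... | no  ≰5 = ≤-antisym (length-N≤6 v) (≰⇒> ≰5)
    ... | yes ≤5 = contradiction 13≤t (<⇒≱ (s≤s (≤-trans (pairSum-edge≤10 (N v) ≤5) (m≤m+n 10 2))))

    t+nonedge≡15 : ∀ v → 13 ≤ t v → t v + pairSum nonedge (N v) ≡ 15
    t+nonedge≡15 v 13≤t = ≡-trans (edge+nonedge (N v)) (length≡6⇒15 (N v) (13≤t⇒length≡6 v 13≤t))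
      where
      length≡6⇒15 : (xs : List (Fin (n G))) → length xs ≡ 6 → pairSum (λ _ _ → 1) xs ≡ 15
      length≡6⇒15 (_ ∷ _ ∷ _ ∷ _ ∷ _ ∷ _ ∷ []) _ = refl

    saturated : ∀ v → 13 ≤ t v →
      t v ≤ 13 × ∃[ a ] ∃[ a′ ] ∃[ b ] ∃[ b′ ] ∃[ c ] ∃[ d ] Saturated v a a′ b b′ c d
    saturated v 13≤t with pairSum-positive (N v) 1≤nonedge
      where
      1≤nonedge : 1 ≤ pairSum nonedge (N v)
      1≤nonedge with N v | N-~ v | 13≤t⇒length≡6 v 13≤t
      ... | x ∷ xs | _ ∷ v~xs | len =
        -- Dropping the first of the six neighbours leaves five, which already contain a non-edge.
        ≤-trans (five-neighbours v~xs (cong pred len)) (m≤n+m _ (∑ xs (nonedge x)))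
    ... | a , a′ , xs , N↭₁ , 1≤aa′
        with All-resp-↭ N↭₁ (N-~ v) | suc-injective (suc-injective (≡-trans (≡-sym (↭-length N↭₁)) (13≤t⇒length≡6 v 13≤t)))
    ... | v~a ∷ v~a′ ∷ v~xs | length≡4
        -- There are at most 15 - 13 = 2 non-edges, and `aa′` is one. Omitting `a′` or `a` leaves
        -- five neighbours, which must contain a non-edge. A non-edge from `a` to `xs` is not among
        -- the neighbours other than `a`, and likewise for `a′`, so a single further non-edge serves
        -- both omissions only if it lies inside `xs`.
        with slack (∑ xs (nonedge a)) (∑ xs (nonedge a′)) 1≤aa′
               (five-neighbours (v~a ∷ v~xs) (cong suc length≡4)) (five-neighbours (v~a′ ∷ v~xs) (cong suc length≡4))
               (subst (_≤ 2) (pairSum-↭ nonedge-sym N↭₁) nonedge≤2)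
      where
      nonedge≤2 : pairSum nonedge (N v) ≤ 2
      nonedge≤2 = +-cancelˡ-≤ 13 _ 2 (≤-trans (+-monoˡ-≤ _ 13≤t) (≤-reflexive (t+nonedge≡15 v 13≤t)))
    ... | Sa≡0 , Sa′≡0 , xs≡1 with pairSum-positive xs (≤-reflexive (≡-sym xs≡1))
    ... | b , b′ , ys , xs↭ys , 1≤bb′
        with ys | xs↭ys | suc-injective (suc-injective (≡-trans (≡-sym (↭-length xs↭ys)) length≡4))
    ... | c ∷ d ∷ [] | xs↭ | _
        with split₁ 1≤bb′ (≡-trans (≡-sym (pairSum-↭ nonedge-sym xs↭)) xs≡1)
    ... | Sb≡0 , rest≡0
        with pairSum-nonedge≡0 (c ∷ d ∷ []) (m+n≡0⇒n≡0 (∑ (c ∷ d ∷ []) (nonedge b′)) rest≡0)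
    ... | (c~d ∷ []) ∷ _ = t≤13 , a , a′ , b , b′ , c , d , record
      { N↭   = trans N↭₁ (prep a (prep a′ xs↭))
      ; a≁a′ = 1≤𝟙⇒T 1≤aa′
      ; b≁b′ = 1≤𝟙⇒T 1≤bb′
      ; a~   = All-resp-↭ xs↭ (adjacent xs Sa≡0)
      ; a′~  = All-resp-↭ xs↭ (adjacent xs Sa′≡0)
      ; b~   = adjacent (c ∷ d ∷ []) Sb≡0
      ; b′~  = adjacent (c ∷ d ∷ []) (m+n≡0⇒m≡0 _ rest≡0)
      ; c~d  = c~d }
      where
      adjacent : ∀ {w} xs → ∑ xs (nonedge w) ≡ 0 → All (w ~_) xs
      adjacent xs eq = All.map nonedge≡0⇒~ (∑≡0⇒All xs eq)
      2≤nonedge : 2 ≤ pairSum nonedge (N v)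
      2≤nonedge = subst (2 ≤_) (≡-sym (pairSum-↭ nonedge-sym N↭₁))
        (+-mono-≤ (≤-trans 1≤aa′ (m≤m+n _ _)) (≤-trans (≤-reflexive (≡-sym xs≡1)) (m≤n+m _ (∑ xs (nonedge a′)))))
      t≤13 : t v ≤ 13
      t≤13 = +-cancelʳ-≤ 2 _ 13 (≤-trans (+-monoʳ-≤ (t v) 2≤nonedge) (≤-reflexive (t+nonedge≡15 v 13≤t)))

    -- Six distinct neighbours already exhaust the degree bound, so nothing remains of `N v` once
    -- they are split off.
    N⊆ : ∀ {v x xs} → Unique xs → All (v ~_) xs → length xs ≡ 6 → v ~ x → x ∈ xs
    N⊆ {v} {x} {xs} uniq v~xs len v~x with Unique⇒↭++ uniq (All.map ∈N v~xs)
    ... | zs , N↭zs with zs | N↭zs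
    ...   | []     | N↭xs = subst (x ∈_) (++-identityʳ xs) (∈-resp-↭ N↭xs (∈N v~x))
    ...   | z ∷ ws | N↭ws = contradiction (length-N≤6 v) (<⇒≱ (begin-strict
      6                              ≡⟨ len ⟨
      length xs                      <⟨ m<m+n (length xs) (s≤s z≤n) ⟩
      length xs + length (z ∷ ws)    ≡⟨ length-++ xs ⟨
      length (xs ++ z ∷ ws)          ≡⟨ ↭-length N↭ws ⟨
      length (N v)                   ∎))
      where open ≤-Reasoning

    -- The six vertices `v`, `a`, `a′`, `b`, `b′`, `d` are all adjacent to `c` and fill its degree;
    -- each of them other than `v` is a neighbour of `v`.
    twin : ∀ {v a a′ b b′ c d x} → Saturated v a a′ b b′ c d → c ~ x → x ≡ v ⊎ v ~ x
    twin {v} {a} {a′} {b} {b′} {c} {d} {x} s c~x =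
      go (All-resp-↭ (N↭ s) (N-~ v)) (Unique-resp-↭ (N↭ s) (N-unique v)) (a~ s) (a′~ s) (b~ s) (b′~ s)
      where
      go : All (v ~_) (a ∷ a′ ∷ b ∷ b′ ∷ c ∷ d ∷ []) → Unique (a ∷ a′ ∷ b ∷ b′ ∷ c ∷ d ∷ []) →
           All (a ~_) (b ∷ b′ ∷ c ∷ d ∷ []) → All (a′ ~_) (b ∷ b′ ∷ c ∷ d ∷ []) →
           All (b ~_) (c ∷ d ∷ []) → All (b′ ~_) (c ∷ d ∷ []) → x ≡ v ⊎ v ~ x
      go (v~a ∷ v~a′ ∷ v~b ∷ v~b′ ∷ v~c ∷ v~d ∷ [])
         ((a≢a′ ∷ a≢b ∷ a≢b′ ∷ _ ∷ a≢d ∷ []) ∷ (a′≢b ∷ a′≢b′ ∷ _ ∷ a′≢d ∷ []) ∷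
          (b≢b′ ∷ _ ∷ b≢d ∷ []) ∷ (_ ∷ b′≢d ∷ []) ∷ _)
         (_ ∷ _ ∷ a~c ∷ _) (_ ∷ _ ∷ a′~c ∷ _) (b~c ∷ _) (b′~c ∷ _) =
        cases (N⊆ uniq (~-sym v~c ∷ ~-sym a~c ∷ ~-sym a′~c ∷ ~-sym b~c ∷ ~-sym b′~c ∷ c~d s ∷ []) refl c~x)
        where
        v~rest : All (v ~_) (a ∷ a′ ∷ b ∷ b′ ∷ d ∷ [])
        v~rest = v~a ∷ v~a′ ∷ v~b ∷ v~b′ ∷ v~d ∷ []
        uniq : Unique (v ∷ a ∷ a′ ∷ b ∷ b′ ∷ d ∷ [])
        uniq = All.map ~⇒≢ v~rest ∷ (a≢a′ ∷ a≢b ∷ a≢b′ ∷ a≢d ∷ []) ∷ (a′≢b ∷ a′≢b′ ∷ a′≢d ∷ []) ∷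
               (b≢b′ ∷ b≢d ∷ []) ∷ (b′≢d ∷ []) ∷ [] ∷ []
        cases : x ∈ v ∷ a ∷ a′ ∷ b ∷ b′ ∷ d ∷ [] → x ≡ v ⊎ v ~ x
        cases (here x≡v)    = inj₁ x≡v
        cases (there x∈rest) = inj₂ (All.lookup v~rest x∈rest)

    -- Five neighbours of `a` are known: `b`, `b′`, `v`, `c`, `d`. Without a sixth, `N a` has at
    -- most 10 edges. A sixth one, `x`, misses `v`, `c` and `d`, which together with `bb′` makes
    -- four non-edges among 15 pairs.
    t-a≤11 : ∀ {v a a′ b b′ c d} → Saturated v a a′ b b′ c d → t a ≤ 11
    t-a≤11 {v} {a} {a′} {b} {b′} {c} {d} s =
      go (All-resp-↭ (N↭ s) (N-~ v)) (Unique-resp-↭ (N↭ s) (N-unique v)) (a~ s)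
      where
      outside-vertex : ∀ {x} → N a ↭ x ∷ b ∷ b′ ∷ v ∷ c ∷ d ∷ [] → t a ≤ 11
      outside-vertex {x} Na↭ = +-cancelʳ-≤ 4 (t a) 11 (≤-trans (+-monoʳ-≤ (t a) 4≤nonedge) (≤-reflexive total))
        where
        a~x : a ~ x
        a~x = All.head (All-resp-↭ Na↭ (N-~ a))
        x∉ : All (x ≢_) (b ∷ b′ ∷ v ∷ c ∷ d ∷ [])
        x∉ = AllPairs.head (Unique-resp-↭ Na↭ (N-unique a))
        v≁x : ¬ v ~ x
        v≁x v~x with ∈-resp-↭ (N↭ s) (∈N v~x)
        -- Each member of `N v` is excluded as a value of `x`: `a` and `a′` are not adjacent to `a`,
        -- and the other four are listed in `N a` besides `x`.
        ... | here refl = ~-irrefl a~x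
        ... | there (here refl) = ~⇒¬≁ a~x (a≁a′ s)
        ... | there (there (here refl)) = All.lookup x∉ (here refl) refl
        ... | there (there (there (here refl))) = All.lookup x∉ (there (here refl)) refl
        ... | there (there (there (there x∈cd))) = All.lookup x∉ (there (there (there x∈cd))) refl
        c≁x : ¬ c ~ x
        c≁x c~x with twin s c~x
        ... | inj₁ x≡v = All.lookup x∉ (there (there (here refl))) x≡v
        ... | inj₂ v~x = v≁x v~x
        d≁x : ¬ d ~ x
        d≁x d~x with twin (swap-cd s) d~x
        ... | inj₁ x≡v = All.lookup x∉ (there (there (here refl))) x≡v
        ... | inj₂ v~x = v≁x v~x
        nonadjacent : ∀ {w} → ¬ w ~ x → nonedge x w ≡ 1
        nonadjacent w≁x = 𝟙-T (¬~⇒≁ (w≁x ∘ ~-sym))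
        total : t a + pairSum nonedge (N a) ≡ 15
        total = ≡-trans (edge+nonedge (N a)) (pairSum-↭ (λ _ _ → refl) Na↭)
        4≤nonedge : 4 ≤ pairSum nonedge (N a)
        4≤nonedge rewrite pairSum-↭ nonedge-sym Na↭ | nonadjacent v≁x | nonadjacent c≁x | nonadjacent d≁x | 𝟙-T (b≁b′ s) =
          -- The 3 counts the non-edges from `x` to `v`, `c`, `d`; the 1 is `bb′`.
          +-mono-≤ {3} {_} {1} (m≤n⇒m≤o+n (nonedge x b) (m≤n⇒m≤o+n (nonedge x b′) ≤-refl)) (s≤s z≤n)

      remaining : ∀ zs → N a ↭ (b ∷ b′ ∷ v ∷ c ∷ d ∷ []) ++ zs → t a ≤ 11
      remaining []            Na↭ = ≤-trans (pairSum-edge≤10 (N a) (≤-reflexive (↭-length Na↭))) (m≤m+n 10 1)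
      remaining (x ∷ [])      Na↭ = outside-vertex (trans Na↭ (++-comm (b ∷ b′ ∷ v ∷ c ∷ d ∷ []) (x ∷ [])))
      remaining (x ∷ y ∷ zs)  Na↭ = contradiction (length-N≤6 a) (<⇒≱ (subst (6 <_) (≡-sym (↭-length Na↭)) (m≤m+n 7 _)))

      go : All (v ~_) (a ∷ a′ ∷ b ∷ b′ ∷ c ∷ d ∷ []) → Unique (a ∷ a′ ∷ b ∷ b′ ∷ c ∷ d ∷ []) →
           All (a ~_) (b ∷ b′ ∷ c ∷ d ∷ []) → t a ≤ 11
      go (v~a ∷ _ ∷ v~b ∷ v~b′ ∷ v~c ∷ v~d ∷ [])
         (_ ∷ _ ∷ (b≢b′ ∷ b≢c ∷ b≢d ∷ []) ∷ (b′≢c ∷ b′≢d ∷ []) ∷ _)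
         (a~b ∷ a~b′ ∷ a~c ∷ a~d ∷ []) = remaining (proj₁ superset) (proj₂ superset)
        where
        uniq : Unique (b ∷ b′ ∷ v ∷ c ∷ d ∷ [])
        uniq = (b≢b′ ∷ ~⇒≢ (~-sym v~b) ∷ b≢c ∷ b≢d ∷ []) ∷ (~⇒≢ (~-sym v~b′) ∷ b′≢c ∷ b′≢d ∷ []) ∷
               (~⇒≢ v~c ∷ ~⇒≢ v~d ∷ []) ∷ (~⇒≢ (c~d s) ∷ []) ∷ [] ∷ []
        superset : ∃[ zs ] N a ↭ (b ∷ b′ ∷ v ∷ c ∷ d ∷ []) ++ zs
        superset = Unique⇒↭++ uniq (All.map ∈N (a~b ∷ a~b′ ∷ ~-sym v~a ∷ a~c ∷ a~d ∷ []))

    -- Double counting between high and low vertices.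

    high low : Fin (n G) → ℕ
    high v = 𝟙 (13 ≤ᵇ t v)
    low v  = 𝟙 (t v ≤ᵇ 11)

    t≤11⇒low≡1 : ∀ {v} → t v ≤ 11 → low v ≡ 1
    t≤11⇒low≡1 t≤11 = 𝟙-T (≤⇒≤ᵇ t≤11)

    t≤12⇒high≡0 : ∀ {v} → t v ≤ 12 → high v ≡ 0
    t≤12⇒high≡0 {v} t≤12 = 𝟙-¬T (λ 13≤t → <⇒≱ (s≤s t≤12) (≤ᵇ⇒≤ 13 (t v) 13≤t))

    -- By `saturated` a high vertex exceeds 12 by exactly one, and a low vertex has at least one to
    -- spare. Summed over all vertices, this reduces the average bound to comparing the numbers of
    -- high and low vertices.
    t+low≤12+high : ∀ v → t v + low v ≤ 12 + high v
    t+low≤12+high v with 13 ≤? t v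
    ... | yes 13≤t rewrite 𝟙-T (≤⇒≤ᵇ 13≤t) | 𝟙-¬T {t v ≤ᵇ 11} (λ t≤11 → <⇒≱ (≤-trans (m≤m+n 12 1) 13≤t) (≤ᵇ⇒≤ (t v) 11 t≤11)) | +-identityʳ (t v) =
      proj₁ (saturated v 13≤t)
    ... | no 13≰t with t v ≤? 11
    ...   | yes t≤11 = ≤-trans (+-mono-≤ t≤11 (𝟙≤1 (t v ≤ᵇ 11))) (m≤m+n 12 _)
    ...   | no  t≰11 rewrite 𝟙-¬T {t v ≤ᵇ 11} (t≰11 ∘ ≤ᵇ⇒≤ (t v) 11) | +-identityʳ (t v) =
      ≤-trans (≮⇒≥ 13≰t) (m≤m+n 12 _)

    -- The factor `high v` makes the inequality trivial at vertices that are not high, so it can be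
    -- summed over all of `V`.
    four-low-neighbours : ∀ v → high v * 4 ≤ high v * ∑ (N v) low
    four-low-neighbours v with 13 ≤? t v
    ... | no 13≰t rewrite t≤12⇒high≡0 {v} (≮⇒≥ 13≰t) = z≤n
    ... | yes 13≤t with saturated v 13≤t
    ...   | _ , a , a′ , b , b′ , c , d , s = *-monoʳ-≤ (high v) 4≤
      where
      4≤ : 4 ≤ ∑ (N v) low
      4≤ rewrite ∑-↭ low (N↭ s)
               | t≤11⇒low≡1 {a} (t-a≤11 s)
               | t≤11⇒low≡1 {a′} (t-a≤11 (swap-aa′ s))
               | t≤11⇒low≡1 {b} (t-a≤11 (swap-ab s))
               | t≤11⇒low≡1 {b′} (t-a≤11 (swap-aa′ (swap-ab s))) = m≤m+n 4 _

    two-not-high : ∀ {u x y} → u ~ x → u ~ y → x ≢ y → t x ≤ 11 → t y ≤ 11 → ∑ (N u) high ≤ 4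
    two-not-high {u} {x} {y} u~x u~y x≢y tx≤11 ty≤11
      with Unique⇒↭++ {ys = N u} ((x≢y ∷ []) ∷ [] ∷ []) (∈N u~x ∷ ∈N u~y ∷ [])
    ... | zs , Nu↭
      rewrite ∑-↭ high Nu↭ | t≤12⇒high≡0 {x} (m≤n⇒m≤1+n tx≤11) | t≤12⇒high≡0 {y} (m≤n⇒m≤1+n ty≤11) =
      ≤-trans (∑-≤-length zs (λ w → 𝟙≤1 (13 ≤ᵇ t w)))
              (≤-pred (≤-pred (subst (_≤ 6) (↭-length Nu↭) (length-N≤6 u))))

    -- If `u` has a high neighbour `v`, then `u` lies in `N v`. From `a` or `a′` both `b` and `b′`
    -- are adjacent; from the other four both `a` and `a′` are. Such a pair is low, leaving at most
    -- four of the six places.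
    high-neighbours≤4 : ∀ u → ∑ (N u) high ≤ 4
    high-neighbours≤4 u with 1 ≤? ∑ (N u) high
    ... | no ∑≡0 = ≤-trans (≮⇒≥ ∑≡0) z≤n
    ... | yes 1≤∑ with ∑-positive (N u) 1≤∑
    ... | v , _ , Nu↭ , 1≤high with All-resp-↭ Nu↭ (N-~ u)
    ... | u~v ∷ _ with saturated v (≤ᵇ⇒≤ 13 (t v) (1≤𝟙⇒T 1≤high))
    ... | _ , a , a′ , b , b′ , c , d , s
        with ∈-resp-↭ (N↭ s) (∈N (~-sym u~v)) | Unique-resp-↭ (N↭ s) (N-unique v) | a~ s | a′~ s | b~ s | b′~ s
    ... | u∈ | (a≢a′ ∷ _) ∷ _ ∷ (b≢b′ ∷ _) ∷ _
        | a~b ∷ a~b′ ∷ a~c ∷ a~d ∷ [] | a′~b ∷ a′~b′ ∷ a′~c ∷ a′~d ∷ []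
        | b~c ∷ b~d ∷ [] | b′~c ∷ b′~d ∷ [] = cases u∈
      where
      via-a : u ~ a → u ~ a′ → ∑ (N u) high ≤ 4
      via-a u~a u~a′ = two-not-high u~a u~a′ a≢a′ (t-a≤11 s) (t-a≤11 (swap-aa′ s))
      via-b : u ~ b → u ~ b′ → ∑ (N u) high ≤ 4
      via-b u~b u~b′ = two-not-high u~b u~b′ b≢b′ (t-a≤11 (swap-ab s)) (t-a≤11 (swap-aa′ (swap-ab s)))
      cases : u ∈ a ∷ a′ ∷ b ∷ b′ ∷ c ∷ d ∷ [] → ∑ (N u) high ≤ 4
      cases (here refl)                                         = via-b a~b a~b′
      cases (there (here refl))                                 = via-b a′~b a′~b′
      cases (there (there (here refl)))                         = via-a (~-sym a~b) (~-sym a′~b)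
      cases (there (there (there (here refl))))                 = via-a (~-sym a~b′) (~-sym a′~b′)
      cases (there (there (there (there (here refl)))))         = via-a (~-sym a~c) (~-sym a′~c)
      cases (there (there (there (there (there (here refl)))))) = via-a (~-sym a~d) (~-sym a′~d)

    ∑high≤∑low : ∑ V high ≤ ∑ V low
    ∑high≤∑low = *-cancelˡ-≤ 4 (begin
      4 * ∑ V high                                          ≡⟨ ∑-*ˡ V 4 high ⟨
      ∑ V (λ v → 4 * high v)                                ≡⟨ ∑-cong V (λ v → *-comm 4 (high v)) ⟩
      ∑ V (λ v → high v * 4)                                ≤⟨ ∑-mono V four-low-neighbours ⟩
      ∑ V (λ v → high v * ∑ (N v) low)                      ≡⟨ ∑-cong V (λ v → expand v high low) ⟩
      -- This double sum counts the ordered adjacent pairs of a high `v` and a low `u`; exchanging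
      -- the sums regroups them by `u`.
      ∑ V (λ v → ∑ V (λ u → high v * (edge v u * low u)))   ≡⟨ ∑-comm V V _ ⟩
      ∑ V (λ u → ∑ V (λ v → high v * (edge v u * low u)))   ≡⟨ ∑-cong V (λ u → ∑-cong V (λ v → reverse u v)) ⟩
      ∑ V (λ u → ∑ V (λ v → low u * (edge u v * high v)))   ≡⟨ ∑-cong V (λ u → expand u low high) ⟨
      ∑ V (λ u → low u * ∑ (N u) high)                      ≤⟨ ∑-mono V (λ u → *-monoʳ-≤ (low u) (high-neighbours≤4 u)) ⟩
      ∑ V (λ u → low u * 4)                                 ≡⟨ ∑-cong V (λ u → *-comm (low u) 4) ⟩
      ∑ V (λ u → 4 * low u)                                 ≡⟨ ∑-*ˡ V 4 low ⟩
      4 * ∑ V low                                           ∎)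
      where
      open ≤-Reasoning
      expand : ∀ v (f g : Fin (n G) → ℕ) → f v * ∑ (N v) g ≡ ∑ V (λ u → f v * (edge v u * g u))
      expand v f g = ≡-trans (cong (f v *_) (∑-filterᵇ (adj G v) g V)) (≡-sym (∑-*ˡ V (f v) _))
      reverse : ∀ u v → high v * (edge v u * low u) ≡ low u * (edge u v * high v)
      reverse u v rewrite edge-sym v u =
        solve 3 (λ h e l → h :* (e :* l) := l :* (e :* h)) refl (high v) (edge u v) (low u)
        where open +-*-Solver

    ∑t≤12n : ∑ V t ≤ 12 * n G
    ∑t≤12n = +-cancelʳ-≤ (∑ V low) _ _ (begin
      ∑ V t + ∑ V low               ≡⟨ ∑-+ V t low ⟨
      ∑ V (λ v → t v + low v)       ≤⟨ ∑-mono V t+low≤12+high ⟩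
      ∑ V (λ v → 12 + high v)       ≡⟨ ∑-+ V (λ _ → 12) high ⟩
      ∑ V (λ _ → 12) + ∑ V high     ≡⟨ cong (_+ ∑ V high) (≡-trans (∑-const V 12) (cong (12 *_) (length-tabulate {n = n G} id))) ⟩
      12 * n G + ∑ V high           ≤⟨ +-monoʳ-≤ (12 * n G) ∑high≤∑low ⟩
      12 * n G + ∑ V low            ∎)
      where open ≤-Reasoning

  -- From neighbourhood counts to the number of triangles.

  triangle : Fin (n G) → Fin (n G) → Fin (n G) → ℕ
  triangle i j l = edge i j * (edge i l * edge j l)

  k₃≤tripleSum : k 3 G ≤ tripleSum triangle V
  k₃≤tripleSum = #subsets₃-≤ {q = isCliqueᵇ G} positive
    where
    positive : ∀ {S i j l} → IsClique G S → i ∈ˢ S → j ∈ˢ S → l ∈ˢ S → i ≢ j → i ≢ l → j ≢ l → 1 ≤ triangle i j l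
    positive S-clique i∈ j∈ l∈ i≢j i≢l j≢l
      rewrite isClique-sound G S-clique i∈ j∈ i≢j
            | isClique-sound G S-clique i∈ l∈ i≢l
            | isClique-sound G S-clique j∈ l∈ j≢l = ≤-refl

  ∑t≡3*tripleSum : ∑ V t ≡ 3 * tripleSum triangle V
  ∑t≡3*tripleSum = ≡-trans
    -- Restricting pairs to `N v` inserts the factors `edge v x` and `edge v y` in just the
    -- bracketing of `triangle v x y`.
    (∑-cong V (λ v → pairSum-filterᵇ (adj G v) edge V))
    (∑-pairSum-symmetric triangle sym₁ sym₂ (λ i l → cong (λ b → 𝟙 b * (edge i l * edge i l)) (irrefl G i)) V)
    where
    sym₁ : ∀ i j l → triangle i j l ≡ triangle j i l
    sym₁ i j l = cong₂ _*_ (edge-sym i j) (*-comm (edge i l) (edge j l))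
    sym₂ : ∀ i j l → triangle i j l ≡ triangle i l j
    sym₂ i j l rewrite edge-sym j l =
      solve 3 (λ a b c → a :* (b :* c) := b :* (a :* c)) refl (edge i j) (edge i l) (edge l j)
      where open +-*-Solver

k₃≤4n : (G : Graph) → InClass 6 5 G → 1 * k 3 G ≤ 4 * ∣V∣ G
k₃≤4n G (deg≤6 , ω≤5) rewrite *-identityˡ (k 3 G) = *-cancelˡ-≤ 3 (begin
  3 * k 3 G                                 ≤⟨ *-monoʳ-≤ 3 (k₃≤tripleSum G) ⟩
  3 * tripleSum (triangle G) (allFin (n G)) ≡⟨ ∑t≡3*tripleSum G ⟨
  ∑ (allFin (n G)) (t G)                    ≤⟨ ∑t≤12n G deg≤6 ω≤5 ⟩
  12 * n G                                  ≡⟨ *-assoc 3 4 (n G) ⟩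
  3 * (4 * n G)                             ∎)
  where open ≤-Reasoning

-- The extremal graph.

T₄[8] : Graph
T₄[8] = turán 4 8

T₄[8]∈𝒢 : InClass 6 5 T₄[8]
T₄[8]∈𝒢 = from-yes (all? (λ i → degree T₄[8] i ≤? 6)) , ω≤5
  where
  no-large-clique : ¬ (∃[ S ] IsClique T₄[8] S × 5 < ∣ S ∣)
  -- Decided by evaluation over the 256 subsets of the eight vertices.
  no-large-clique = from-no (anySubset? (λ S → isCliqueᵇ T₄[8] S Bool.≟ true ×-dec 6 ≤? ∣ S ∣))
  ω≤5 : CliqueNumberAtMost 5 T₄[8]
  ω≤5 S clique = ≮⇒≥ (λ 5<∣S∣ → no-large-clique (S , clique , 5<∣S∣))

theorem6p8 : FEquals 3 6 5 4 1 × RhoEquals 3 (turán 4 8) 4 1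
-- The supremum is attained, so one graph serves every `p` and `q`. It has 32 triangles: four
-- choices of three parts, and 2 * 2 * 2 choices of vertices in them. The closing `refl` evaluates
-- this count.
theorem6p8 = (k₃≤4n , (λ p q _ p<4q → T₄[8] , T₄[8]∈𝒢 , dense p q p<4q)) , refl
  where
  dense : ∀ p q → p * 1 < 4 * q → p * 8 < q * 32
  dense p q p<4q = begin-strict
    p * 8           ≡⟨ cong (_* 8) (*-identityʳ p) ⟨
    p * 1 * 8       <⟨ *-monoˡ-< 8 p<4q ⟩
    4 * q * 8       ≡⟨ solve 1 (λ q → con 4 :* q :* con 8 := q :* con 32) refl q ⟩
    q * 32          ∎
    where
    open ≤-Reasoning
    open +-*-Solver
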